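{- Let $d\ge 1$ be a positive integer. Then there exists an infinite class of (pairwise non-isomorphic) graphs $G$ such that $$\rho^{\operatorname{Dist}(G)}(G)=d=\rho^{\operatorname{Fix}(G)+1}(G).$$
   Context: All graphs are finite and simple. A coloring of the vertices of a graph $G$ with $m$ colors (a map from $V(G)$ to a set of $m$ colors, not required to use every color) is $m$-distinguishing if the only automorphism of $G$ preserving the color classes (i.e. mapping each color class to itself) is the trivial one. The distinguishing number $\operatorname{Dist}(G)$ is the smallest $m$ for which $G$ has an $m$-distinguishing coloring. For $m\ge \operatorname{Dist}(G)$, the $m$-paint cost $\rho^m(G)$ is the minimum size of the complement of a color class over all $m$-distinguishing colorings of $G$. A set $S\subseteq V(G)$ is a fixing set for $G$ if the only automorphism of $G$ that fixes every element of $S$ is the trivial one; the fixing number $\operatorname{Fix}(G)$ is the smallest cardinality of a fixing set. -}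

module Defs where

open import Data.Fin using (Fin; _≟_)
open import Data.Fin.Permutation using (Permutation; _⟨$⟩ʳ_; _≈_; id)
open import Data.Fin.Subset using (Subset; _∈_; ∁; ∣_∣)
open import Data.Nat using (ℕ; _≤_)
open import Data.Product using (Σ; ∃-syntax; _×_; proj₁)
open import Data.Vec using (tabulate)
open import Function.Bundles using (_⇔_)
open import Level using (0ℓ)
open import Relation.Binary.Core using (Rel)
open import Relation.Binary.Definitions using (Decidable; Irreflexive; Symmetric)
open import Relation.Binary.PropositionalEquality using (_≡_)
open import Relation.Nullary using (does)

record Graph : Set₁ where
  field
    order      : ℕ
    Adj        : Rel (Fin order) 0ℓ
    adj-sym    : Symmetric Adj
    adj-irrefl : Irreflexive _≡_ Adj
    adj?       : Decidable Adj

  Vertex : Set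
  Vertex = Fin order

open Graph public using (order; Adj; Vertex)

infix 4 _≅_

_≅_ : Graph → Graph → Set
G ≅ H = Σ (Permutation (order G) (order H)) λ π →
  ∀ u v → Adj G u v ⇔ Adj H (π ⟨$⟩ʳ u) (π ⟨$⟩ʳ v)

Automorphism : Graph → Set
Automorphism G = G ≅ G

Trivial : (G : Graph) → Automorphism G → Set
Trivial G σ = proj₁ σ ≈ id

-- The numerical invariants below are minima, given as relations between a
-- graph and a number; a minimum is unique when it exists, by antisymmetry
-- of ≤.
IsMinimum : (ℕ → Set) → ℕ → Set
IsMinimum P k = P k × (∀ j → P j → k ≤ j)

Coloring : Graph → ℕ → Set
Coloring G m = Vertex G → Fin m

colorClass : (G : Graph) {m : ℕ} → Coloring G m → Fin m → Subset (order G)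
colorClass G c i = tabulate λ v → does (c v ≟ i)

Preserves : (G : Graph) {m : ℕ} → Automorphism G → Coloring G m → Set
Preserves G σ c = ∀ v → c (proj₁ σ ⟨$⟩ʳ v) ≡ c v

Distinguishing : (G : Graph) {m : ℕ} → Coloring G m → Set
Distinguishing G c = (σ : Automorphism G) → Preserves G σ c → Trivial G σ

IsDist : Graph → ℕ → Set
IsDist G = IsMinimum λ m → ∃[ c ] Distinguishing G {m} c

-- IsPaintCost m G k says that ρᵐ(G) = k.  Since it provides an
-- m-distinguishing coloring, it entails m ≥ Dist(G).
IsPaintCost : ℕ → Graph → ℕ → Set
IsPaintCost m G = IsMinimum λ k →
  ∃[ c ] Distinguishing G {m} c × ∃[ i ] ∣ ∁ (colorClass G c i) ∣ ≡ k

Fixing : (G : Graph) → Subset (order G) → Set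
Fixing G S =
  (σ : Automorphism G) → (∀ v → v ∈ S → proj₁ σ ⟨$⟩ʳ v ≡ v) → Trivial G σ

IsFix : Graph → ℕ → Set
IsFix G = IsMinimum λ k → ∃[ S ] Fixing G S × ∣ S ∣ ≡ k

{-# OPTIONS --safe #-}

-- A broom consists of d + 1 leaves joined to one end of a path.  The leaves
-- are its only pairs of distinct twins, so every automorphism preserves the
-- distance to the leaves and fixes the path pointwise; conversely every
-- permutation of the leaves extends to an automorphism.  Hence a colouring
-- is distinguishing exactly when it separates the leaves, and a set is fixing
-- exactly when it misses at most one leaf.  Thus Dist = d + 1 = Fix + 1.
-- The complement of a colour class of a distinguishing colouring is a fixing
-- set, so every paint cost is at least Fix = d.

module Submission where

open import Defs
open import Data.Nat using (ℕ; _+_; _≤_)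
open import Data.Product using (Σ-syntax; ∃-syntax; _×_)
open import Relation.Binary.PropositionalEquality using (_≢_)
open import Relation.Nullary using (¬_)

open import Data.Bool using (not)
open import Data.Fin using (Fin; zero; suc; toℕ; fromℕ<; splitAt; punchIn; _↑ˡ_; _↑ʳ_; _≟_)
open import Data.Fin.Permutation
  using (Permutation; transpose; flip; inverseˡ; inverseʳ; ↔⇒≡; _⟨$⟩ʳ_; _⟨$⟩ˡ_)
open import Data.Fin.Properties
  using (toℕ-injective; toℕ<n; toℕ-fromℕ<; splitAt-↑ˡ; splitAt-↑ʳ; splitAt⁻¹-↑ˡ;
         splitAt⁻¹-↑ʳ; ↑ˡ-injective; punchInᵢ≢i; injective⇒≤)
  renaming (suc-injective to Fin-suc-injective)
open import Data.Fin.Subset using (Subset; inside; outside; _∈_; _∉_; ∁; ∣_∣)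
open import Data.Fin.Subset.Properties using (_∈?_; drop-there; Empty-unique; ∣⊥∣≡0)
open import Data.Nat using (zero; suc; z≤n; s≤s)
open import Data.Nat.Properties
  using (+-comm; +-cancelˡ-≡; suc-injective; m≢1+n+m; ≤-trans; n≤1+n; m≤n+m)
  renaming (_≟_ to _≟ℕ_)
open import Data.Product using (_,_; proj₂)
open import Data.Sum using (_⊎_; inj₁; inj₂; [_,_]′)
import Data.Sum as Sum
open import Data.Vec using (_∷_; lookup; here; there)
open import Data.Vec.Properties
  using (lookup∘tabulate; lookup-map; []=⇒lookup; lookup⇒[]=)
open import Function using (id; const; _∘_)
open import Function.Bundles using (_⇔_; mk⇔; Equivalence)
open import Relation.Binary.PropositionalEquality
  using (_≡_; refl; sym; trans; cong; subst; subst₂)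
open import Relation.Nullary using (yes; no; does; contradiction)
open import Relation.Nullary.Decidable using (_⊎-dec_; dec-true; dec-false)

open Equivalence using (to; from)

-- Transpositions

transpose-invariant : ∀ {n} {A : Set} (f : Fin n → A) {i j} → f i ≡ f j →
  ∀ k → f (transpose i j ⟨$⟩ʳ k) ≡ f k
transpose-invariant f {i} {j} fi≡fj k with k ≟ i
... | yes refl = sym fi≡fj
... | no _ with k ≟ j
...   | yes refl = fi≡fj
...   | no _     = refl

transpose-left : ∀ {n} (i j : Fin n) → transpose i j ⟨$⟩ʳ i ≡ j
transpose-left i j rewrite dec-true (i ≟ i) refl = refl

transpose-other : ∀ {n} {i j k : Fin n} → k ≢ i → k ≢ j → transpose i j ⟨$⟩ʳ k ≡ k
transpose-other {i = i} {j} {k} k≢i k≢j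
  rewrite dec-false (k ≟ i) k≢i | dec-false (k ≟ j) k≢j = refl

-- Counting subsets by an initial segment

prefix⊆⇒≤ : ∀ m {k} (S : Subset (m + k)) → (∀ i → i ↑ˡ k ∈ S) → m ≤ ∣ S ∣
prefix⊆⇒≤ zero    S             prefix⊆S = z≤n
prefix⊆⇒≤ (suc m) (inside  ∷ S) prefix⊆S =
  s≤s (prefix⊆⇒≤ m S (drop-there ∘ prefix⊆S ∘ suc))
prefix⊆⇒≤ (suc m) (outside ∷ S) prefix⊆S with () ← prefix⊆S zero

-- If the first index is missing, then no other one is, so the remaining `m` are all present;
-- otherwise it counts one and the induction continues.
almostPrefix⊆⇒≤ : ∀ m {k} (S : Subset (suc m + k)) →
  (∀ i j → i ↑ˡ k ∉ S → j ↑ˡ k ∉ S → i ≡ j) → m ≤ ∣ S ∣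
almostPrefix⊆⇒≤ m {k} (outside ∷ S) missing-≡ = prefix⊆⇒≤ m S member
  where
  member : ∀ i → i ↑ˡ k ∈ S
  member i with i ↑ˡ k ∈? S
  ... | yes i∈S = i∈S
  ... | no  i∉S with () ← missing-≡ zero (suc i) (λ ()) (i∉S ∘ drop-there)
almostPrefix⊆⇒≤ zero    (inside ∷ S) missing-≡ = z≤n
almostPrefix⊆⇒≤ (suc m) (inside ∷ S) missing-≡ = s≤s (almostPrefix⊆⇒≤ m S λ i j i∉S j∉S →
  Fin-suc-injective
    (missing-≡ (suc i) (suc j) (i∉S ∘ drop-there) (j∉S ∘ drop-there)))

∣prefix∣ : ∀ m {k} (S : Subset (m + k)) →
  (∀ i → i ↑ˡ k ∈ S) → (∀ j → m ↑ʳ j ∉ S) → ∣ S ∣ ≡ m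
∣prefix∣ zero {k} S _ ∉S rewrite Empty-unique {p = S} (λ (j , j∈S) → ∉S j j∈S) = ∣⊥∣≡0 k
∣prefix∣ (suc m) (inside  ∷ S) ∈S ∉S =
  cong suc (∣prefix∣ m S (drop-there ∘ ∈S ∘ suc) (λ j → ∉S j ∘ there))
∣prefix∣ (suc m) (outside ∷ S) ∈S ∉S with () ← ∈S zero

-- Automorphisms and complements of colour classes

inverse : ∀ {G} → Automorphism G → Automorphism G
inverse {G} (π , iso) = flip π , λ u v → mk⇔
  (λ e → from (iso _ _) (subst₂ (Adj G) (sym (inverseʳ π)) (sym (inverseʳ π)) e))
  (λ e → subst₂ (Adj G) (inverseʳ π) (inverseʳ π) (to (iso _ _) e))

adj-transfer : ∀ {G} ((π , _) : Automorphism G) w x →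
  Adj G w (π ⟨$⟩ʳ x) ⇔ Adj G (π ⟨$⟩ˡ w) x
adj-transfer {G} σ@(π , _) w x =
  subst (λ y → Adj G w (π ⟨$⟩ʳ x) ⇔ Adj G (π ⟨$⟩ˡ w) y) (inverseˡ π)
    (proj₂ (inverse {G} σ) w (π ⟨$⟩ʳ x))

lookup-∁colorClass : ∀ G {m} (c : Coloring G m) i v →
  lookup (∁ (colorClass G c i)) v ≡ not (does (c v ≟ i))
lookup-∁colorClass G c i v =
  trans (lookup-map v not (colorClass G c i)) (cong not (lookup∘tabulate _ v))

∈∁colorClass : ∀ G {m} (c : Coloring G m) i {v} → c v ≢ i → v ∈ ∁ (colorClass G c i)
∈∁colorClass G c i {v} cv≢i = lookup⇒[]= v _
  (trans (lookup-∁colorClass G c i v) (cong not (dec-false (c v ≟ i) cv≢i)))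

∉∁colorClass : ∀ G {m} (c : Coloring G m) i {v} → c v ≡ i → v ∉ ∁ (colorClass G c i)
∉∁colorClass G c i {v} cv≡i v∈
  with () ← trans (sym (trans (lookup-∁colorClass G c i v)
                              (cong not (dec-true (c v ≟ i) cv≡i))))
                  ([]=⇒lookup v∈)

-- If σ fixes the vertices outside class i, then it maps class i to itself.
∁colorClass-fixing : ∀ G {m} {c : Coloring G m} → Distinguishing G c →
  ∀ i → Fixing G (∁ (colorClass G c i))
∁colorClass-fixing G {c = c} dist i σ@(π , _) fixes = dist σ preserves
  where
  fixed : ∀ v → c v ≢ i → π ⟨$⟩ʳ v ≡ v
  fixed v cv≢i = fixes v (∈∁colorClass G c i cv≢i)
  preserves : Preserves G σ c
  preserves v with c v ≟ i
  ... | no cv≢i = cong c (fixed v cv≢i)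
  ... | yes cv≡i with c (π ⟨$⟩ʳ v) ≟ i
  ...   | yes cσv≡i = trans cσv≡i (sym cv≡i)
  -- Here `σ` fixes the image of `v`, so by injectivity it fixes `v`.
  ...   | no  cσv≢i = cong c
          (trans (sym (inverseˡ π)) (trans (cong (π ⟨$⟩ˡ_) (fixed _ cσv≢i)) (inverseˡ π)))

fix≤paintCost : ∀ G {f m k} → IsFix G f →
  ∃[ c ] Distinguishing G {m} c × ∃[ i ] ∣ ∁ (colorClass G c i) ∣ ≡ k → f ≤ k
fix≤paintCost G (_ , least) (c , dist , i , size) =
  least _ (_ , ∁colorClass-fixing G dist i , size)

-- Twins on a path

Consecutive : ℕ → ℕ → Set
Consecutive m n = suc m ≡ n ⊎ suc n ≡ m

-- If `a` is positive, its predecessor must also be next to `b`, which leaves `b = a` or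
-- `b = a - 2`. In the latter case, position 3 (if `b = 0`) or the predecessor of `b` tells the two
-- apart. Were `L = 2`, the positions 0 and 2 would be twins.
twins-on-path : ∀ {L a b} → 3 ≤ L → a ≤ L →
  (∀ i → i ≤ L → Consecutive i a ⇔ Consecutive i b) → a ≡ 0 ⊎ a ≡ b
twins-on-path {a = zero}  3≤L a≤L twins = inj₁ refl
twins-on-path {a = suc a} 3≤L a≤L twins
  with to (twins a (≤-trans (n≤1+n a) a≤L)) (inj₁ refl)
... | inj₁ sa≡b = inj₂ sa≡b
twins-on-path {b = zero} 3≤L a≤L twins | inj₂ refl with to (twins 3 3≤L) (inj₂ refl)
...   | inj₁ ()
...   | inj₂ ()
twins-on-path {b = suc b} 3≤L a≤L twins | inj₂ refl
  with from (twins b (≤-trans (m≤n+m b 3) a≤L)) (inj₁ refl)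
...   | inj₁ sb≡3+b = contradiction sb≡3+b (m≢1+n+m (suc b) {1})
...   | inj₂ 4+b≡b = contradiction (sym 4+b≡b) (m≢1+n+m b {3})

-- The broom graph

module Broom (d′ n : ℕ) where

  -- With only two path vertices, the far end of the path would be a twin of the leaves.
  d pathLength : ℕ
  d = suc d′
  pathLength = 3 + n

  leaf : Fin (suc d) → Fin (suc d + pathLength)
  leaf i = i ↑ˡ pathLength

  -- The distance from the set of leaves.
  rank : Fin (suc d + pathLength) → ℕ
  rank v = [ const 0 , suc ∘ toℕ ]′ (splitAt (suc d) v)

  -- Adjacency depends on ranks alone, so every rank-preserving permutation is an automorphism. Only
  -- rank 0 is shared by several vertices.
  broom : Graph
  broom = record
    { order      = suc d + pathLength
    ; Adj        = λ u v → Consecutive (rank u) (rank v)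
    ; adj-sym    = Sum.swap
    ; adj-irrefl = λ { refl (inj₁ eq) → m≢1+n+m _ {0} (sym eq)
                     ; refl (inj₂ eq) → m≢1+n+m _ {0} (sym eq) }
    ; adj?       = λ u v → (suc (rank u) ≟ℕ rank v) ⊎-dec (suc (rank v) ≟ℕ rank u)
    }

  rank-leaf : ∀ i → rank (leaf i) ≡ 0
  rank-leaf i rewrite splitAt-↑ˡ (suc d) i pathLength = refl

  rank≡0⇒leaf : ∀ v → rank v ≡ 0 → ∃[ i ] leaf i ≡ v
  rank≡0⇒leaf v rank≡0 with inj₁ i ← splitAt (suc d) v in eq = i , splitAt⁻¹-↑ˡ eq

  rank-injective : ∀ u v → rank u ≡ rank v → u ≡ v ⊎ rank u ≡ 0
  rank-injective u v ru≡rv with splitAt (suc d) u in eqᵘ | splitAt (suc d) v in eqᵛ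
  ... | inj₁ _ | _ = inj₂ refl
  ... | inj₂ i | inj₂ j with refl ← toℕ-injective (suc-injective ru≡rv) =
    inj₁ (trans (sym (splitAt⁻¹-↑ʳ eqᵘ)) (splitAt⁻¹-↑ʳ eqᵛ))

  rank≤ : ∀ v → rank v ≤ pathLength
  rank≤ v with splitAt (suc d) v
  ... | inj₁ _ = z≤n
  ... | inj₂ j = toℕ<n j

  rank-surjective : ∀ {i} → i ≤ pathLength → ∃[ v ] rank v ≡ i
  rank-surjective {zero}  _   = leaf zero , refl
  rank-surjective {suc i} i<L = suc d ↑ʳ fromℕ< i<L ,
    trans (cong [ const 0 , suc ∘ toℕ ]′ (splitAt-↑ʳ (suc d) pathLength (fromℕ< i<L)))
          (cong suc (toℕ-fromℕ< i<L))

  -- Twins and the invariance of rank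

  Twins : Vertex broom → Vertex broom → Set
  Twins u v = ∀ w → Adj broom w u ⇔ Adj broom w v

  twins⇒rank≡0 : ∀ u v → u ≢ v → Twins u v → rank u ≡ 0
  twins⇒rank≡0 u v u≢v twins with twins-on-path (s≤s (s≤s (s≤s z≤n))) (rank≤ u) rank-twins
    where
    rank-twins : ∀ i → i ≤ pathLength → Consecutive i (rank u) ⇔ Consecutive i (rank v)
    rank-twins i i≤L with w , refl ← rank-surjective i≤L = twins w
  ... | inj₁ ru≡0 = ru≡0
  ... | inj₂ ru≡rv with rank-injective u v ru≡rv
  ...   | inj₁ u≡v  = contradiction u≡v u≢v
  ...   | inj₂ ru≡0 = ru≡0

  rank-invariant⇒automorphism : (π : Permutation (order broom) (order broom)) →
    (∀ v → rank (π ⟨$⟩ʳ v) ≡ rank v) → Automorphism broom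
  rank-invariant⇒automorphism π inv = π , λ u v → mk⇔
    (subst₂ Consecutive (sym (inv u)) (sym (inv v))) (subst₂ Consecutive (inv u) (inv v))

  leaf-swap : (i j : Fin (suc d)) → Automorphism broom
  leaf-swap i j = rank-invariant⇒automorphism (transpose (leaf i) (leaf j))
    (transpose-invariant rank (trans (rank-leaf i) (sym (rank-leaf j))))

  leaf-swap-trivial : ∀ i j → Trivial broom (leaf-swap i j) → i ≡ j
  leaf-swap-trivial i j trivial = ↑ˡ-injective pathLength i j
    (trans (sym (trivial (leaf i))) (transpose-left (leaf i) (leaf j)))

  automorphism-leaf : ∀ ((π , _) : Automorphism broom) i → rank (π ⟨$⟩ʳ leaf i) ≡ 0
  automorphism-leaf σ@(π , _) i = twins⇒rank≡0 (π ⟨$⟩ʳ leaf i) (π ⟨$⟩ʳ leaf j) distinct twins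
    where
    j : Fin (suc d)
    -- A second leaf, available because `d` is positive.
    j = punchIn i zero
    distinct : π ⟨$⟩ʳ leaf i ≢ π ⟨$⟩ʳ leaf j
    distinct eq = punchInᵢ≢i i zero (sym (↑ˡ-injective pathLength i j
      (trans (sym (inverseˡ π)) (trans (cong (π ⟨$⟩ˡ_) eq) (inverseˡ π)))))
    leaf-twins : ∀ w → Consecutive (rank w) (rank (leaf i)) ⇔ Consecutive (rank w) (rank (leaf j))
    leaf-twins w rewrite rank-leaf i | rank-leaf j = mk⇔ id id
    twins : Twins (π ⟨$⟩ʳ leaf i) (π ⟨$⟩ʳ leaf j)
    -- Pull `w` back along `σ`, exchange the twin leaves, and push forward again.
    twins w = mk⇔
      (from (moved j) ∘ to (leaf-twins (π ⟨$⟩ˡ w)) ∘ to (moved i))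
      (from (moved i) ∘ from (leaf-twins (π ⟨$⟩ˡ w)) ∘ to (moved j))
      where
      moved : ∀ k → Adj broom w (π ⟨$⟩ʳ leaf k) ⇔ Adj broom (π ⟨$⟩ˡ w) (leaf k)
      moved k = adj-transfer {broom} σ w (leaf k)

  -- Quantifying over all automorphisms lets the induction on `k` use the inverse as well.
  PreservesRank : ℕ → Set
  PreservesRank k = ∀ ((π , _) : Automorphism broom) v → rank v ≡ k → rank (π ⟨$⟩ʳ v) ≡ k

  -- A neighbour of `v` of rank `k` keeps its rank, and its image stays adjacent to that of `v`.
  next-rank : ∀ {k} → PreservesRank k → ∀ ((π , _) : Automorphism broom) v →
    rank v ≡ suc k → Consecutive k (rank (π ⟨$⟩ʳ v))
  next-rank {k} preserves σ@(π , iso) v rv≡sk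
    with w , rw≡k ← rank-surjective
           (≤-trans (n≤1+n k) (subst (_≤ pathLength) rv≡sk (rank≤ v))) =
    subst (λ r → Consecutive r (rank (π ⟨$⟩ʳ v))) (preserves σ w rw≡k)
      (to (iso w v) (inj₁ (trans (cong suc rw≡k) (sym rv≡sk))))

  preserves-rank : ∀ k → PreservesRank k
  preserves-rank zero σ v rv≡0 with i , refl ← rank≡0⇒leaf v rv≡0 = automorphism-leaf σ i
  preserves-rank (suc zero) σ v rv≡1 with next-rank (preserves-rank 0) σ v rv≡1
  ... | inj₁ 1≡rσv = sym 1≡rσv
  preserves-rank (suc (suc k)) σ@(π , _) v rv≡ with next-rank (preserves-rank (suc k)) σ v rv≡
  ... | inj₁ ≡rσv = sym ≡rσv
  -- If the image dropped to rank `k`, the inverse automorphism would give `v` rank `k` too.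
  ... | inj₂ rσv≡ = contradiction (trans (sym rv≡k) rv≡) (m≢1+n+m k {1})
    where
    rv≡k : rank v ≡ k
    rv≡k = subst (λ x → rank x ≡ k) (inverseˡ π)
      (preserves-rank k (inverse {broom} σ) (π ⟨$⟩ʳ v) (suc-injective rσv≡))

  -- Colourings, fixing sets and the invariants

  -- The path shares its colour with the first leaf, so that only the other `d` leaves lie outside
  -- that class.
  leafColor : Coloring broom (suc d)
  leafColor v = [ id , const zero ]′ (splitAt (suc d) v)

  leafColor-leaf : ∀ i → leafColor (leaf i) ≡ i
  leafColor-leaf i rewrite splitAt-↑ˡ (suc d) i pathLength = refl

  leafColor-path : ∀ j → leafColor (suc d ↑ʳ j) ≡ zero
  leafColor-path j rewrite splitAt-↑ʳ (suc d) pathLength j = refl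

  leafColor-distinguishing : Distinguishing broom leafColor
  leafColor-distinguishing σ@(π , _) preserves v
    with rank-injective (π ⟨$⟩ʳ v) v (preserves-rank _ σ v refl)
  ... | inj₁ σv≡v = σv≡v
  ... | inj₂ rσv≡0
    with i , leafᵢ≡σv ← rank≡0⇒leaf _ rσv≡0
       | j , leafⱼ≡v ← rank≡0⇒leaf v (trans (sym (preserves-rank _ σ v refl)) rσv≡0) =
    trans (sym leafᵢ≡σv) (trans (cong leaf i≡j) leafⱼ≡v)
    where
    i≡j : i ≡ j
    i≡j = trans (sym (leafColor-leaf i)) (trans (cong leafColor leafᵢ≡σv)
      (trans (preserves v) (trans (cong leafColor (sym leafⱼ≡v)) (leafColor-leaf j))))

  -- Swapping two leaves of equal colour preserves the colouring.
  distinguishing⇒leaves-separated : ∀ {m} {c : Coloring broom m} → Distinguishing broom c →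
    ∀ {i j} → c (leaf i) ≡ c (leaf j) → i ≡ j
  distinguishing⇒leaves-separated {c = c} dist {i} {j} ci≡cj =
    leaf-swap-trivial i j (dist (leaf-swap i j) (transpose-invariant c ci≡cj))

  fixing⇒misses≤1leaf : ∀ {S} → Fixing broom S → ∀ i j → leaf i ∉ S → leaf j ∉ S → i ≡ j
  fixing⇒misses≤1leaf fixing i j i∉S j∉S = leaf-swap-trivial i j
    (fixing (leaf-swap i j) λ v v∈S →
      transpose-other (λ { refl → i∉S v∈S }) (λ { refl → j∉S v∈S }))

  ∣∁leafColor₀∣ : ∣ ∁ (colorClass broom leafColor zero) ∣ ≡ d
  -- The first leaf is outside the complement and adds nothing to its size; the count runs over the
  -- tail.
  ∣∁leafColor₀∣ = ∣prefix∣ d _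
    (λ i → drop-there (∈∁colorClass broom leafColor zero
      (λ eq → contradiction (trans (sym (leafColor-leaf (suc i))) eq) (λ ()))))
    (λ j → ∉∁colorClass broom leafColor zero (leafColor-path j) ∘ there)

  isDist : IsDist broom (suc d)
  isDist = (leafColor , leafColor-distinguishing) ,
    λ m (c , dist) → injective⇒≤ (distinguishing⇒leaves-separated dist)

  isFix : IsFix broom d
  isFix = (_ , ∁colorClass-fixing broom leafColor-distinguishing zero , ∣∁leafColor₀∣) ,
    λ { k (S , fixing , refl) → almostPrefix⊆⇒≤ d S (fixing⇒misses≤1leaf fixing) }

  isPaintCost : IsPaintCost (suc d) broom d
  isPaintCost = (leafColor , leafColor-distinguishing , zero , ∣∁leafColor₀∣) ,
    λ k → fix≤paintCost broom isFix

open Broom using (broom; isDist; isFix; isPaintCost)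

theorem5 : (d : ℕ) → 1 ≤ d →
    Σ[ G ∈ (ℕ → Graph) ] ((∀ (i j : ℕ) → i ≢ j → ¬ (G i ≅ G j)) ×
    (∀ (i : ℕ) →
    (∃[ m ] (IsDist (G i) m × IsPaintCost m (G i) d)) ×
    (∃[ f ] (IsFix (G i) f × IsPaintCost (f + 1) (G i) d))))
theorem5 (suc d) _ = broom d ,
  -- Isomorphic graphs have equal orders, and the orders here are `(2 + d) + (3 + i)`.
  (λ i j i≢j (π , _) → i≢j (+-cancelˡ-≡ 3 i j (+-cancelˡ-≡ (2 + d) (3 + i) (3 + j) (↔⇒≡ π)))) ,
  λ i → (2 + d , isDist d i , isPaintCost d i) ,
        (1 + d , isFix d i ,
         subst (λ m → IsPaintCost m (broom d i) (suc d)) (+-comm 1 (suc d)) (isPaintCost d i))
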